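{- For each fixed integer $l\ge 1$, letting $P_l$ denote the path with $l$ edges, \[ \frac{l-1}{2}\,n\sim \mathrm{ex}(n,P_l)\le \mathrm{ex}^*(n,P_l)\le \left\lceil\frac{3l-2}{2}\right\rceil n, \] where $\sim$ refers to $n\to\infty$.
   Context: $\mathrm{ex}(n,F)$ is the usual Turán number: the maximum number of edges in an $n$-vertex graph containing no copy of $F$. $\mathrm{ex}^*(n,F)$ (the rainbow Turán number) is the maximum number of edges in an $n$-vertex graph that admits a proper edge-coloring containing no rainbow copy of $F$, i.e. no copy of $F$ all of whose edges receive different colors. -}

module Defs where

open import Data.Nat using (ℕ; zero; suc; _+_; _*_; _≤_; _<ᵇ_)
open import Data.Bool using (Bool; true; false; if_then_else_; _∧_)
open import Data.Fin using (Fin; toℕ; inject₁)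
open import Data.List using (List; map; allFin)
open import Data.Nat.ListAction using (sum)
open import Data.Product using (Σ; _×_)
open import Relation.Binary.PropositionalEquality using (_≡_; _≢_)
open import Function.Definitions using (Injective)

record Graph (n : ℕ) : Set where
  field
    adj   : Fin n → Fin n → Bool
    sym   : ∀ i j → adj i j ≡ adj j i
    irrefl : ∀ i → adj i i ≡ false
open Graph public

edges : ∀ {n} → Graph n → ℕ
edges {n} G =
  sum (map (λ i → sum (map (λ j → if (toℕ j <ᵇ toℕ i) ∧ adj G i j then 1 else 0)
                             (allFin n)))
           (allFin n))

record PathCopy {n : ℕ} (G : Graph n) (l : ℕ) : Set where
  field
    vtx    : Fin (suc l) → Fin n
    inj    : Injective _≡_ _≡_ vtx
    isEdge : ∀ (i : Fin l) → adj G (vtx (inject₁ i)) (vtx (Fin.suc i)) ≡ true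
open PathCopy public

PathFree : ∀ {n} → Graph n → ℕ → Set
PathFree G l = PathCopy G l → Data.Empty.⊥
  where import Data.Empty

record ProperColouring {n : ℕ} (G : Graph n) : Set where
  field
    col    : Fin n → Fin n → ℕ
    colSym : ∀ u v → adj G u v ≡ true → col u v ≡ col v u
    proper : ∀ u v w → adj G u v ≡ true → adj G u w ≡ true → v ≢ w →
             col u v ≢ col u w
open ProperColouring public

pathColour : ∀ {n l} {G : Graph n} → ProperColouring G → PathCopy G l → Fin l → ℕ
pathColour c p i = col c (vtx p (inject₁ i)) (vtx p (Fin.suc i))

Rainbow : ∀ {n l} {G : Graph n} → ProperColouring G → PathCopy G l → Set
Rainbow c p = Injective _≡_ _≡_ (pathColour c p)

RainbowPathFree : ∀ {n} → Graph n → ℕ → Set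
RainbowPathFree G l =
  Σ (ProperColouring G) λ c → ∀ (p : PathCopy G l) → Rainbow c p → Data.Empty.⊥
  where import Data.Empty

IsEx : ℕ → ℕ → ℕ → Set
IsEx n l m =
  (Σ (Graph n) λ G → PathFree G l × edges G ≡ m) ×
  (∀ (G : Graph n) → PathFree G l → edges G ≤ m)

IsExStar : ℕ → ℕ → ℕ → Set
IsExStar n l m =
  (Σ (Graph n) λ G → RainbowPathFree G l × edges G ≡ m) ×
  (∀ (G : Graph n) → RainbowPathFree G l → edges G ≤ m)

{-# OPTIONS --safe #-}
module Submission where

-- Both upper bounds peel off vertices: a vertex of small degree can be deleted, so all degrees may
-- be assumed large, and then a path with k < l edges from u to v can be lengthened as follows.
-- Plain case: unless u or v has a neighbour off the path, degree u + degree v > k yields a path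
-- edge yz with u ~ z and v ~ y, so the path vertices carry a cycle.  Either some edge leaves the
-- cycle and gives a longer path, or the at most l path vertices can be peeled off as a whole.
-- Rainbow case: unless u or v extends the path directly, edges leaving the path at v have colours
-- of the path, and edges at u with new colours end on the path.  Counting gives a path edge yz such
-- that u ~ z has a new colour and some v ~ w leaving the path has the colour of yz; replacing yz
-- by uz and adding vw gives a longer rainbow path.
-- The lower bound comes from disjoint cliques on l vertices.

open import Defs renaming (sym to adj-sym)
open import Data.Nat using (ℕ; zero; suc; _+_; _*_; _∸_; _^_; _≤_; _<_; z≤n; s≤s; _<ᵇ_; ⌈_/2⌉; ⌊_/2⌋; NonZero)
import Data.Nat as ℕ
open import Data.Nat.DivMod
open import Data.Nat.Divisibility using (n∣m*n)
open import Data.Nat.ListAction using (sum)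
open import Data.Nat.ListAction.Properties using (sum-++; sum-↭)
open import Data.Nat.Properties hiding (_≟_; suc-injective)
import Data.Nat.Properties as ℕ
open import Data.Nat.Tactic.RingSolver using (solve-∀)
open import Data.Bool using (Bool; true; false; if_then_else_; _∧_; not)
import Data.Bool.Properties as Bool
open import Data.Fin using (Fin; zero; suc; toℕ; inject₁; fromℕ<; finToFun; funToFin; combine; remQuot)
open import Data.Fin.Properties using (toℕ-injective; _≟_; toℕ<n; toℕ-fromℕ<; pigeonhole; finToFun-funToFin; remQuot-combine; any?; all?)
open import Data.List using (List; []; _∷_; _++_; [_]; map; length; allFin)
open import Data.List.Properties using (map-++; map-∘; length-++; length-map; length-tabulate; map-tabulate)
open import Data.List.Membership.Propositional using (_∈_; _∉_; find; lose)
open import Data.List.Membership.Propositional.Properties using (∈-∃++; ∈-++⁺ʳ; ∈-map⁻; ∈-allFin)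
import Data.List.Membership.DecPropositional as DecMembership
open import Data.List.Relation.Unary.Any as Any using (here; there)
open import Data.List.Relation.Unary.All as All using ([]; _∷_)
open import Data.List.Relation.Unary.All.Properties using (¬Any⇒All¬)
open import Data.List.Relation.Unary.AllPairs using ([]; _∷_)
open import Data.List.Relation.Unary.Unique.Propositional using (Unique)
import Data.List.Relation.Unary.Unique.Propositional.Properties as Unique
open import Data.List.Relation.Binary.Permutation.Propositional as Perm using (_↭_; ↭-sym; ↭-trans; ↭-reflexive; prep; swap; ↭⇒↭ₛ)
import Data.List.Relation.Binary.Permutation.Propositional.Properties as Perm
import Data.List.Relation.Binary.Permutation.Setoid.Properties as PermS
open import Data.Product using (Σ; ∃; _×_; _,_; proj₁; proj₂)
open import Data.Sum using (_⊎_; inj₁; inj₂)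
open import Data.Empty using (⊥-elim)
open import Data.Unit using (⊤; tt)
open import Function using (_∘_; id; mk⇔; Equivalence)
open import Relation.Nullary using (¬_; Dec; yes; no; does)
open import Relation.Nullary.Decidable using (map′; _×-dec_; _→-dec_; ¬?; dec-true; dec-false; decidable-stable; does-⇔)
open import Relation.Unary using (Decidable)
open import Relation.Binary.Definitions using (tri<; tri≈; tri>)
open import Relation.Binary.PropositionalEquality using (_≡_; _≢_; refl; sym; trans; cong; cong₂; subst; subst₂; setoid; _≗_; module ≡-Reasoning)

-- Counting over lists

indicator : Bool → ℕ
indicator b = if b then 1 else 0

sumOver : ∀ {A : Set} → (A → ℕ) → List A → ℕ
sumOver f xs = sum (map f xs)

count : ∀ {A : Set} → (A → Bool) → List A → ℕ
count f = sumOver (indicator ∘ f)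

private variable
  A B : Set

sumOver-cong : {f g : A → ℕ} → (∀ x → f x ≡ g x) → ∀ xs → sumOver f xs ≡ sumOver g xs
sumOver-cong e [] = refl
sumOver-cong e (x ∷ xs) = cong₂ _+_ (e x) (sumOver-cong e xs)

sumOver-mono : {f g : A → ℕ} → ∀ xs → (∀ {x} → x ∈ xs → f x ≤ g x) → sumOver f xs ≤ sumOver g xs
sumOver-mono [] h = z≤n
sumOver-mono (x ∷ xs) h = +-mono-≤ (h (here refl)) (sumOver-mono xs (h ∘ there))

sumOver-++ : (f : A → ℕ) → ∀ xs ys → sumOver f (xs ++ ys) ≡ sumOver f xs + sumOver f ys
sumOver-++ f xs ys = trans (cong sum (map-++ f xs ys)) (sum-++ (map f xs) (map f ys))

sumOver-↭ : (f : A → ℕ) {xs ys : List A} → xs ↭ ys → sumOver f xs ≡ sumOver f ys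
sumOver-↭ f p = sum-↭ (Perm.map⁺ f p)

sumOver-∘ : (f : B → ℕ) (h : A → B) → ∀ xs → sumOver f (map h xs) ≡ sumOver (f ∘ h) xs
sumOver-∘ f h xs = cong sum (sym (map-∘ xs))

sumOver-const : (c : ℕ) → ∀ (xs : List A) → sumOver (λ _ → c) xs ≡ c * length xs
sumOver-const c [] = sym (*-zeroʳ c)
sumOver-const c (x ∷ xs) = trans (cong (c +_) (sumOver-const c xs)) (sym (*-suc c (length xs)))

sumOver-+ : (f g : A → ℕ) → ∀ xs → sumOver (λ x → f x + g x) xs ≡ sumOver f xs + sumOver g xs
sumOver-+ f g [] = refl
sumOver-+ f g (x ∷ xs) rewrite sumOver-+ f g xs = lem (f x) (g x) (sumOver f xs) (sumOver g xs)
  where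
  lem : ∀ a b c d → a + b + (c + d) ≡ a + c + (b + d)
  lem = solve-∀

sumOver-swap : (f : A → B → ℕ) → ∀ xs ys →
  sumOver (λ x → sumOver (f x) ys) xs ≡ sumOver (λ y → sumOver (λ x → f x y) xs) ys
sumOver-swap f [] ys = sym (sumOver-const 0 ys)
sumOver-swap f (x ∷ xs) ys =
  trans (cong (sumOver (f x) ys +_) (sumOver-swap f xs ys))
        (sym (sumOver-+ (f x) (λ y → sumOver (λ x → f x y) xs) ys))

indicator≤1 : ∀ b → indicator b ≤ 1
indicator≤1 true = ≤-refl
indicator≤1 false = z≤n

count≤length : (f : A → Bool) → ∀ xs → count f xs ≤ length xs
count≤length f xs = ≤-trans (sumOver-mono xs (λ {x} _ → indicator≤1 (f x)))
  (≤-reflexive (trans (sumOver-const 1 xs) (*-identityˡ _)))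

count-shift : (f : A → Bool) → ∀ xs {x ys} → f x ≡ true → count f (xs ++ x ∷ ys) ≡ suc (count f (xs ++ ys))
count-shift f xs {x} {ys} fx = trans (sumOver-↭ (indicator ∘ f) (Perm.shift x xs ys))
  (cong (λ b → indicator b + count f (xs ++ ys)) fx)

∈-delete : ∀ {x z : A} xs {ys} → z ∈ xs ++ x ∷ ys → z ≢ x → z ∈ xs ++ ys
∈-delete {x = x} xs {ys} z∈ z≢x with Perm.∈-resp-↭ (Perm.shift x xs ys) z∈
... | here z≡x = ⊥-elim (z≢x z≡x)
... | there z∈′ = z∈′

-- Induction on `xs`: the image of the head is deleted from `ys`, and injectivity keeps the later
-- images in what remains. Injectivity concerns counted elements only, because `h` will be the
-- colour of the edge to a neighbour, and properness speaks of neighbours alone.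
count-injection : (h : A → B) (f : A → Bool) (g : B → Bool) → ∀ {xs ys} → Unique xs →
  (∀ {x} → x ∈ xs → f x ≡ true → h x ∈ ys × g (h x) ≡ true) →
  (∀ {x y} → x ∈ xs → y ∈ xs → f x ≡ true → f y ≡ true → h x ≡ h y → x ≡ y) →
  count f xs ≤ count g ys
count-injection h f g {[]} _ _ _ = z≤n
count-injection h f g {x ∷ xs} (x∉ ∷ u) into inj with f x in fx
... | false = count-injection h f g u (into ∘ there) (λ p q → inj (there p) (there q))
... | true with into (here refl) fx
...   | hx∈ , ghx with ∈-∃++ hx∈
...     | ys₁ , ys₂ , refl = subst (suc (count f xs) ≤_) (sym (count-shift g ys₁ ghx))
  (s≤s (count-injection h f g u
    (λ y∈ fy → let hy∈ , ghy = into (there y∈) fy in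
       ∈-delete ys₁ hy∈ (λ e → All.lookup x∉ y∈ (sym (inj (there y∈) (here refl) fy fx e))) , ghy)
    (λ p q → inj (there p) (there q))))

count-⊆ : (f g : A → Bool) → ∀ {xs ys} → Unique xs →
  (∀ {x} → x ∈ xs → f x ≡ true → x ∈ ys × g x ≡ true) → count f xs ≤ count g ys
count-⊆ f g u into = count-injection id f g u into (λ _ _ _ _ e → e)

count<length : (f : A → Bool) → ∀ {x xs} → x ∈ xs → f x ≡ false → count f xs < length xs
count<length f {x} x∈ fx with ∈-∃++ x∈
... | ys , zs , refl rewrite sumOver-↭ (indicator ∘ f) (Perm.shift x ys zs)
                           | Perm.↭-length (Perm.shift x ys zs) | fx = s≤s (count≤length f (ys ++ zs))

count-split : (f g : A → Bool) → ∀ xs → count f xs ≡ count (λ x → f x ∧ g x) xs + count (λ x → f x ∧ not (g x)) xs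
count-split f g xs = trans (sumOver-cong pt xs) (sumOver-+ _ _ xs)
  where
  pt : ∀ x → indicator (f x) ≡ indicator (f x ∧ g x) + indicator (f x ∧ not (g x))
  pt x with f x | g x
  ... | false | _ = refl
  ... | true | true = refl
  ... | true | false = refl

-- Finds the step of a path at which to rotate: the two counts come from the two ends of the path
-- and together exceed the number of steps.
count-pigeonhole : (a b : A → Bool) → ∀ xs → length xs < count a xs + count b xs →
  ∃ λ x → x ∈ xs × a x ≡ true × b x ≡ true
count-pigeonhole a b (x ∷ xs) h with a x in ax | b x in bx
... | true | true = x , here refl , ax , bx
... | false | false = let y , y∈ , p = count-pigeonhole a b xs (<-trans (n<1+n _) h) in y , there y∈ , p
... | true | false = let y , y∈ , p = count-pigeonhole a b xs (≤-pred h) in y , there y∈ , p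
... | false | true = let y , y∈ , p = count-pigeonhole a b xs (≤-pred (subst (suc (suc (length xs)) ≤_) (+-suc (count a xs) (count b xs)) h)) in y , there y∈ , p

Unique-resp-↭ : {xs ys : List A} → xs ↭ ys → Unique xs → Unique ys
Unique-resp-↭ p = PermS.Unique-resp-↭ (setoid _) (↭⇒↭ₛ p)

split-off : ∀ {xs : List A} {S} → Unique xs → (∀ {x} → x ∈ xs → x ∈ S) → ∃ λ R → S ↭ xs ++ R
split-off {xs = []} {S} _ _ = S , Perm.refl
split-off {xs = x ∷ xs} (x∉ ∷ u) sub with ∈-∃++ (sub (here refl))
... | S₁ , S₂ , refl with split-off u (λ y∈ → ∈-delete S₁ (sub (there y∈)) (λ e → All.lookup x∉ y∈ (sym e)))
...   | R , p = R , ↭-trans (Perm.shift x S₁ S₂) (prep x p)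

Unique-++ʳ : ∀ (xs : List A) {ys} → Unique (xs ++ ys) → Unique ys
Unique-++ʳ [] u = u
Unique-++ʳ (_ ∷ xs) (_ ∷ u) = Unique-++ʳ xs u

Unique-++-disjoint : ∀ (xs : List A) {ys x} → Unique (xs ++ ys) → x ∈ ys → x ∉ xs
Unique-++-disjoint (y ∷ xs) (y∉ ∷ u) x∈ys (here refl) =
  All.lookup y∉ (∈-++⁺ʳ xs x∈ys) refl
Unique-++-disjoint (y ∷ xs) (_ ∷ u) x∈ys (there x∈) = Unique-++-disjoint xs u x∈ys x∈

-- Adjacent pairs and the peeling of vertices

module Degrees {n : ℕ} (G : Graph n) where
  private V = Fin n

  degree : List V → V → ℕ
  degree S v = count (adj G v) S

  -- Adjacent pairs are ordered: for duplicate-free `S`, `between S S` is twice the number of edges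
  -- inside `S`, so that no halves occur in the bounds.
  between : List V → List V → ℕ
  between S T = sumOver (degree T) S

  between-++ : ∀ S T U → between (S ++ T) U ≡ between S U + between T U
  between-++ S T U = sumOver-++ (degree U) S T

  between-sym : ∀ S T → between S T ≡ between T S
  between-sym S T = trans (sumOver-swap (λ s t → indicator (adj G s t)) S T)
    (sumOver-cong (λ t → sumOver-cong (λ s → cong indicator (adj-sym G s t)) S) T)

  -- The pairs starting in `T` are set aside. Those from `R` to `S` are by symmetry as many as those
  -- from `S` to `R`, which split once more along `T ++ R`.
  between-peel : ∀ {S} T R → S ↭ T ++ R → between S S ≡ (between T S + between T R) + between R R
  between-peel {S} T R p = begin
    between S S                              ≡⟨ sumOver-↭ (degree S) p ⟩
    between (T ++ R) S                       ≡⟨ between-++ T R S ⟩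
    between T S + between R S                ≡⟨ cong (between T S +_) (between-sym R S) ⟩
    between T S + between S R                ≡⟨ cong (between T S +_) (sumOver-↭ (degree R) p) ⟩
    between T S + between (T ++ R) R         ≡⟨ cong (between T S +_) (between-++ T R R) ⟩
    between T S + (between T R + between R R) ≡⟨ +-assoc (between T S) _ _ ⟨
    (between T S + between T R) + between R R ∎
    where open ≡-Reasoning

  -- `edges` counts a pair in decreasing order only. Adding the transposed sum counts every ordered
  -- pair once, and the diagonal vanishes by `irrefl`.
  handshake : 2 * edges G ≡ between (allFin n) (allFin n)
  handshake = begin
    2 * edges G ≡⟨ cong (edges G +_) (+-identityʳ _) ⟩
    edges G + edges G ≡⟨ cong (edges G +_) (sumOver-swap below all all) ⟩
    sumOver (λ i → sumOver (below i) all) all + sumOver (λ j → sumOver (λ i → below i j) all) all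
      ≡⟨ sumOver-+ _ _ all ⟨
    sumOver (λ i → sumOver (below i) all + sumOver (λ j → below j i) all) all
      ≡⟨ sumOver-cong (λ i → trans (sym (sumOver-+ (below i) (λ j → below j i) all)) (sumOver-cong (pt i) all)) all ⟩
    between all all ∎
    where
    open ≡-Reasoning
    all = allFin n
    below : V → V → ℕ
    below i j = indicator ((toℕ j <ᵇ toℕ i) ∧ adj G i j)
    <ᵇ-true : ∀ {a b} → a < b → (a <ᵇ b) ≡ true
    <ᵇ-true p = Bool.T-≡ .Equivalence.to (<⇒<ᵇ p)
    <ᵇ-false : ∀ {a b} → ¬ a < b → (a <ᵇ b) ≡ false
    <ᵇ-false {a} {b} np with a <ᵇ b in e
    ... | false = refl
    ... | true = ⊥-elim (np (<ᵇ⇒< a b (Bool.T-≡ .Equivalence.from e)))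
    pt : ∀ i j → below i j + below j i ≡ indicator (adj G i j)
    pt i j with <-cmp (toℕ i) (toℕ j)
    ... | tri< lt _ ¬gt rewrite <ᵇ-true lt | <ᵇ-false ¬gt = cong indicator (adj-sym G j i)
    ... | tri> ¬lt _ gt rewrite <ᵇ-true gt | <ᵇ-false ¬lt = +-identityʳ _
    ... | tri≈ ¬lt eq ¬gt rewrite <ᵇ-false ¬lt | <ᵇ-false ¬gt with toℕ-injective eq
    ... | refl rewrite irrefl G i = refl

  -- The left side of `sparse` is the drop of `between S S` when `part` is deleted; it may cost `c`
  -- per deleted vertex.
  record Peelable (c : ℕ) (S : List V) : Set where
    constructor peelable
    field
      part rest : List V
      splits : S ↭ part ++ rest
      nonempty : 0 < length part
      sparse : between part S + between part rest ≤ c * length part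

  -- Repeated deletion. The induction runs on a bound `k` for the length, as `rest` is shorter than
  -- `S` but no structural part of it.
  peel : ∀ c → (∀ {S} → Unique S → 0 < length S → Peelable c S) →
    ∀ k {S} → length S ≤ k → Unique S → between S S ≤ c * length S
  peel c step k {[]} _ _ = z≤n
  peel c step (suc k) {S@(_ ∷ _)} |S|≤ u with step u (s≤s z≤n)
  ... | peelable T R p T>0 sp = begin
    between S S                                ≡⟨ between-peel T R p ⟩
    (between T S + between T R) + between R R  ≤⟨ +-mono-≤ sp (peel c step k |R|≤ (Unique-++ʳ T (Unique-resp-↭ p u))) ⟩
    c * length T + c * length R                ≡⟨ *-distribˡ-+ c (length T) (length R) ⟨
    c * (length T + length R)                  ≡⟨ cong (c *_) |TR| ⟩
    c * length S                               ∎
    where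
    open ≤-Reasoning
    |TR| : length T + length R ≡ length S
    |TR| = trans (sym (length-++ T)) (sym (Perm.↭-length p))
    |R|≤ : length R ≤ k
    |R|≤ = ≤-pred (≤-trans (+-monoˡ-≤ (length R) T>0) (≤-trans (≤-reflexive |TR|) |S|≤))

  -- Each edge at `v` is lost as two ordered pairs, hence the factor 2.
  peel-vertex : ∀ c {S v} → v ∈ S → 2 * degree S v ≤ c → Peelable c S
  peel-vertex c {v = v} v∈ d≤ with ∈-∃++ v∈
  ... | S₁ , S₂ , refl = peelable [ v ] (S₁ ++ S₂) (Perm.shift v S₁ S₂) (s≤s z≤n)
    (begin
      (degree S v + 0) + (degree R v + 0) ≡⟨ cong₂ _+_ (+-identityʳ (degree S v)) (+-identityʳ (degree R v)) ⟩
      degree S v + degree R v             ≤⟨ +-monoʳ-≤ (degree S v) R≤S ⟩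
      degree S v + degree S v             ≡⟨ cong (degree S v +_) (+-identityʳ _) ⟨
      2 * degree S v                      ≤⟨ d≤ ⟩
      c                                   ≡⟨ *-identityʳ c ⟨
      c * 1                               ∎)
    where
    open ≤-Reasoning
    S = S₁ ++ v ∷ S₂
    R = S₁ ++ S₂
    R≤S : degree R v ≤ degree S v
    R≤S = ≤-trans (m≤n+m _ _) (≤-reflexive (sym (sumOver-↭ (indicator ∘ adj G v) (Perm.shift v S₁ S₂))))

  -- Within `S` no edge leaves `T`, so `between T rest` is zero; and a vertex of `T` has at most
  -- `length T - 1` neighbours, not being adjacent to itself.
  peel-closed : ∀ c {S T} → Unique S → Unique T → 0 < length T → length T ≤ suc c →
    (∀ {v} → v ∈ T → v ∈ S) → (∀ {t w} → t ∈ T → w ∈ S → adj G t w ≡ true → w ∈ T) → Peelable c S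
  peel-closed c {S} {T} uS uT T>0 T≤ sub closed with split-off uT sub
  ... | R , p = peelable T R p T>0 (begin
    between T S + between T R ≤⟨ +-mono-≤ (sumOver-mono T inner) (sumOver-mono T outer) ⟩
    sumOver (λ _ → c) T + sumOver (λ _ → 0) T ≡⟨ cong₂ _+_ (sumOver-const c T) (sumOver-const 0 T) ⟩
    c * length T + 0 ≡⟨ +-identityʳ _ ⟩
    c * length T ∎)
    where
    open ≤-Reasoning
    inner : ∀ {t} → t ∈ T → degree S t ≤ c
    inner {t} t∈ = ≤-pred (≤-trans (s≤s (count-⊆ (adj G t) (adj G t) uS (λ w∈ e → closed t∈ w∈ e , e)))
      (≤-trans (count<length (adj G t) t∈ (irrefl G t)) T≤))
    outer : ∀ {t} → t ∈ T → degree R t ≤ 0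
    outer {t} t∈ = count-⊆ (adj G t) (adj G t) {R} {[]} (Unique-++ʳ T (Unique-resp-↭ p uS))
      (λ w∈ e → ⊥-elim (Unique-++-disjoint T (Unique-resp-↭ p uS) w∈
         (closed t∈ (Perm.∈-resp-↭ (↭-sym p) (∈-++⁺ʳ T w∈)) e)))

-- Paths and rotations

∃∈? : {A : Set} {P : A → Set} → Decidable P → ∀ xs → Dec (∃ λ x → x ∈ xs × P x)
∃∈? P? xs = map′ find (λ (_ , x∈ , px) → lose x∈ px) (Any.any? P? xs)

does-true : {P : Set} (P? : Dec P) → does P? ≡ true → P
does-true (yes p) _ = p

does-not : {P : Set} (P? : Dec P) → not (does P?) ≡ true → ¬ P
does-not (no ¬p) _ = ¬p

∧-true : ∀ {a b} → a ∧ b ≡ true → a ≡ true × b ≡ true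
∧-true {true} {true} _ = refl , refl

module Paths {n : ℕ} {G : Graph n} (c : ProperColouring G) where
  open Degrees G
  private V = Fin n
  Step = V × V

  open DecMembership (_≟_ {n}) using (_∈?_)
  open DecMembership ℕ._≟_ using () renaming (_∈?_ to _∈ᶜ?_)

  private variable
    u v w x y : V
    es es′ : List Step
    vs : List V
    cs : List ℕ

  Adj : V → V → Set
  Adj u v = adj G u v ≡ true

  adj⇄ : Adj u v → Adj v u
  adj⇄ {u} {v} a = trans (adj-sym G v u) a

  Adj? : ∀ u v → Dec (Adj u v)
  Adj? u v = adj G u v Bool.≟ true

  colour-injective : Adj u v → Adj u w → col c u v ≡ col c u w → v ≡ w
  colour-injective {u} {v} {w} a b e = decidable-stable (v ≟ w) (λ v≢w → proper c u v w a b v≢w e)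

  -- The steps form an index, so that cutting a path at a step amounts to cutting a list.
  data Path : V → V → List Step → Set where
    []  : Path u u []
    _∷_ : Adj u w → Path w v es → Path u v ((u , w) ∷ es)

  vertices : V → List Step → List V
  vertices u es = u ∷ map proj₂ es

  colours : List Step → List ℕ
  colours = map (λ (x , y) → col c x y)

  vertices-++ : ∀ es → vertices u (es ++ (x , y) ∷ es′) ≡ vertices u es ++ vertices y es′
  vertices-++ {u} es = cong (u ∷_) (map-++ proj₂ es _)

  length-vertices : ∀ u es → length (vertices u es) ≡ suc (length es)
  length-vertices u es = cong suc (length-map proj₂ es)

  join : Path u x es → Adj x y → Path y v es′ → Path u v (es ++ (x , y) ∷ es′)
  join [] a q = a ∷ q
  join (b ∷ p) a q = b ∷ join p a q

  split : ∀ es → Path u v (es ++ (x , y) ∷ es′) → Path u x es × Adj x y × Path y v es′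
  split [] (a ∷ q) = [] , a , q
  split (_ ∷ es) (b ∷ p) = let p₁ , a , q = split es p in b ∷ p₁ , a , q

  finish∈ : Path u v es → v ∈ vertices u es
  finish∈ [] = here refl
  finish∈ (_ ∷ p) = there (finish∈ p)

  sources : Path u v es → map proj₁ es ++ [ v ] ≡ vertices u es
  sources [] = refl
  sources (_ ∷ p) = cong (_ ∷_) (sources p)

  -- Visited vertices and used colours only matter up to order, which makes reversal and rotation free.
  record PathFrom (u : V) (vs : List V) (cs : List ℕ) : Set where
    constructor pathFrom
    field
      {finish} : V
      {steps} : List Step
      path : Path u finish steps
      visits : vertices u steps ↭ vs
      uses : colours steps ↭ cs

  extend : Adj w u → PathFrom u vs cs → PathFrom w (w ∷ vs) (col c w u ∷ cs)
  extend {w} a (pathFrom p pv pc) = pathFrom (a ∷ p) (prep w pv) (prep _ pc)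

  reversal : Path u v es → ∃ λ es′ → Path v u es′ × vertices v es′ ↭ vertices u es × colours es′ ↭ colours es
  reversal [] = [] , [] , Perm.refl , Perm.refl
  reversal {u} {v} (_∷_ {w = w} a p) with reversal p
  ... | es′ , q , qv , qc = es′ ++ [ (w , u) ] , join q (adj⇄ a) []
      , ↭-trans (↭-reflexive (vertices-++ es′)) (↭-trans (Perm.++-comm (vertices v es′) [ u ]) (prep u qv))
      , ↭-trans (↭-reflexive (trans (map-++ _ es′ _) (cong (λ γ → colours es′ ++ [ γ ]) (sym (colSym c u w a)))))
          (↭-trans (Perm.++-comm (colours es′) [ col c u w ]) (prep _ qc))

  reverse : Path u v es → PathFrom v (vertices u es) (colours es)
  reverse p = let _ , q , qv , qc = reversal p in pathFrom q qv qc

  -- On the path u ... x y ... v the step from `x` to `y` is given up for the chord from `y` to `u`: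
  -- the new path goes back from `v` to `y`, crosses to `u` and goes forward to `x`. The end `v`
  -- stays an end, where a further edge can be attached.
  rotate : ∀ es → Path u v (es ++ (x , y) ∷ es′) → Adj y u →
    ∃ λ es″ → Path v x es″ × vertices v es″ ↭ vertices u (es ++ (x , y) ∷ es′) ×
              colours es″ ↭ col c y u ∷ colours es ++ colours es′
  rotate {u} {v} {x} {y} {es′} es p a with split es p
  ... | p₁ , _ , p₂ with reversal p₂
  ...   | r , q , qv , qc = r ++ (y , u) ∷ es , join q a p₁
      , ↭-trans (↭-reflexive (vertices-++ r))
          (↭-trans (Perm.++⁺ʳ (vertices u es) qv)
            (↭-trans (Perm.++-comm (vertices y es′) (vertices u es)) (↭-reflexive (sym (vertices-++ es)))))
      , ↭-trans (↭-reflexive (map-++ _ r _))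
          (↭-trans (Perm.shift _ (colours r) (colours es))
            (prep _ (↭-trans (Perm.++-comm (colours r) (colours es)) (Perm.++⁺ˡ (colours es) qc))))

  -- The closing edge makes a cycle, which is cut just before `x`. The colours are left open, as
  -- only the uncoloured argument goes around a cycle.
  around-cycle : Path u v es → Adj v u → x ∈ vertices u es → ∃ λ cs → PathFrom x (vertices u es) cs
  around-cycle p a (here refl) = _ , pathFrom p Perm.refl Perm.refl
  around-cycle {u} {v} p a (there x∈) with ∈-map⁻ proj₂ x∈
  ... | (s , t) , e∈ , refl with ∈-∃++ e∈
  ...   | es₁ , es₂ , refl with split es₁ p
  ...     | p₁ , _ , p₂ = _ , pathFrom (join p₂ a p₁)
      (↭-trans (↭-reflexive (vertices-++ es₂))
        (↭-trans (Perm.++-comm (vertices t es₂) (vertices u es₁)) (↭-reflexive (sym (vertices-++ es₁)))))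
      Perm.refl

  -- `Q` unites the two settings: `Any-colours` gives ordinary paths, `Unique` gives rainbow paths.
  -- `S` is the set of vertices not yet peeled off.
  record PathIn (Q : List ℕ → Set) (S : List V) (k : ℕ) : Set where
    field
      {start finish} : V
      {steps} : List Step
      path : Path start finish steps
      distinct : Unique (vertices start steps)
      within : ∀ {v} → v ∈ vertices start steps → v ∈ S
      admissible : Q (colours steps)
      length≡ : length steps ≡ k

  Any-colours : List ℕ → Set
  Any-colours _ = ⊤

  lengthen : ∀ {Q S k} → (∀ {cs cs′} → cs ↭ cs′ → Q cs → Q cs′) →
    PathFrom u vs cs → Unique vs → (∀ {v} → v ∈ vs → v ∈ S) → length vs ≡ suc k →
    w ∈ S → w ∉ vs → Adj u w → Q (col c w u ∷ cs) → PathIn Q S (suc k)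
  lengthen {w = w} resp f uvs sub len w∈ w∉ a q with extend (adj⇄ a) f
  ... | pathFrom {steps = es} p pv pc = record
    { path = p
    ; distinct = Unique-resp-↭ (↭-sym pv) (¬Any⇒All¬ _ w∉ ∷ uvs)
    ; within = λ v∈ → within′ (Perm.∈-resp-↭ pv v∈)
    ; admissible = resp (↭-sym pc) q
    ; length≡ = ℕ.suc-injective (trans (sym (length-vertices w es)) (trans (Perm.↭-length pv) (cong suc len)))
    }
    where
    within′ : ∀ {v} → v ∈ _ ∷ _ → v ∈ _
    within′ (here refl) = w∈
    within′ (there v∈) = sub v∈

  trivial-path : ∀ {Q S} → Q [] → 0 < length S → PathIn Q S 0
  trivial-path {S = x ∷ S} q _ = record
    { path = [] {x} ; distinct = [] ∷ [] ; within = λ { (here refl) → here refl }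
    ; admissible = q ; length≡ = refl }

  -- From inductive paths to path copies

  vertexAt : Path u v es → Fin (suc (length es)) → V
  vertexAt {u} _ zero = u
  vertexAt (_ ∷ p) (suc i) = vertexAt p i

  vertexAt-∈ : (p : Path u v es) → ∀ i → vertexAt p i ∈ vertices u es
  vertexAt-∈ p zero = here refl
  vertexAt-∈ (_ ∷ p) (suc i) = there (vertexAt-∈ p i)

  vertexAt-injective : (p : Path u v es) → Unique (vertices u es) → ∀ i j → vertexAt p i ≡ vertexAt p j → i ≡ j
  vertexAt-injective p _ zero zero _ = refl
  vertexAt-injective (_ ∷ p) (u∉ ∷ _) zero (suc j) e = ⊥-elim (All.lookup u∉ (vertexAt-∈ p j) e)
  vertexAt-injective (_ ∷ p) (u∉ ∷ _) (suc i) zero e = ⊥-elim (All.lookup u∉ (vertexAt-∈ p i) (sym e))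
  vertexAt-injective (_ ∷ p) (_ ∷ uq) (suc i) (suc j) e = cong suc (vertexAt-injective p uq i j e)

  vertexAt-edge : (p : Path u v es) → ∀ i → Adj (vertexAt p (inject₁ i)) (vertexAt p (suc i))
  vertexAt-edge (a ∷ p) zero = a
  vertexAt-edge (_ ∷ p) (suc i) = vertexAt-edge p i

  toCopy : (p : Path u v es) → Unique (vertices u es) → PathCopy G (length es)
  toCopy p uq = record { vtx = vertexAt p ; inj = vertexAt-injective p uq _ _ ; isEdge = vertexAt-edge p }

  colourAt : Path u v es → Fin (length es) → ℕ
  colourAt p i = col c (vertexAt p (inject₁ i)) (vertexAt p (suc i))

  colourAt-∈ : (p : Path u v es) → ∀ i → colourAt p i ∈ colours es
  colourAt-∈ (_ ∷ p) zero = here refl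
  colourAt-∈ (_ ∷ p) (suc i) = there (colourAt-∈ p i)

  colourAt-injective : (p : Path u v es) → Unique (colours es) → ∀ i j → colourAt p i ≡ colourAt p j → i ≡ j
  colourAt-injective (_ ∷ p) _ zero zero _ = refl
  colourAt-injective (_ ∷ p) (γ∉ ∷ _) zero (suc j) e = ⊥-elim (All.lookup γ∉ (colourAt-∈ p j) e)
  colourAt-injective (_ ∷ p) (γ∉ ∷ _) (suc i) zero e = ⊥-elim (All.lookup γ∉ (colourAt-∈ p i) (sym e))
  colourAt-injective (_ ∷ p) (_ ∷ uq) (suc i) (suc j) e = cong suc (colourAt-injective p uq i j e)

  copy : ∀ {Q S k} → PathIn Q S k → PathCopy G k
  copy record { path = p ; distinct = uq ; length≡ = refl } = toCopy p uq

  rainbow-copy : ∀ {S k} (p : PathIn Unique S k) → Rainbow c (copy p)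
  rainbow-copy record { path = p ; admissible = uq ; length≡ = refl } = colourAt-injective p uq _ _

  -- Lengthening a path, colours ignored

  Outside : List V → V → V → Set
  Outside vs t w = w ∉ vs × Adj t w

  outside? : ∀ S vs t → Dec (∃ λ w → w ∈ S × Outside vs t w)
  outside? S vs t = ∃∈? (λ w → ¬? (w ∈? vs) ×-dec Adj? t w) S

  closed : ∀ {S} → ¬ (∃ λ w → w ∈ S × Outside vs u w) → w ∈ S → Adj u w → w ∈ vs
  closed {vs = vs} {w = w} none w∈ a = decidable-stable (w ∈? vs) (λ w∉ → none (w , w∈ , w∉ , a))

  longer-or-peelable : ∀ {S k} l → Unique S → (∀ {v} → v ∈ S → l ≤ 2 * degree S v) → k < l →
    PathIn Any-colours S k → PathIn Any-colours S (suc k) ⊎ Peelable (l ∸ 1) S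
  longer-or-peelable {S} {k} l uS deg k<l
    record { start = u ; finish = v ; steps = es ; path = p ; distinct = uq ; within = sub ; length≡ = len }
    = by-cases (∃∈? (outside? S (vertices u es)) (vertices u es)) (outside? S (vertices u es) u) (outside? S (vertices u es) v)
    where
    |vs| : length (vertices u es) ≡ suc k
    |vs| = trans (length-vertices u es) (cong suc len)

    longer : PathFrom x (vertices u es) cs → w ∈ S → w ∉ vertices u es → Adj x w → PathIn Any-colours S (suc k)
    longer f w∈ w∉ a = lengthen (λ _ _ → tt) f uq sub |vs| w∈ w∉ a tt

    -- All neighbours of `v` lie on the path, and the path vertices other than `v` are exactly the
    -- sources of steps. For `u` below, they are the targets.
    finish-degree : ¬ (∃ λ w → w ∈ S × Outside (vertices u es) v w) →
      degree S v ≤ count (adj G v ∘ proj₁) es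
    finish-degree none = begin
      degree S v ≤⟨ count-⊆ (adj G v) (adj G v) uS (λ w∈ a → closed none w∈ a , a) ⟩
      count (adj G v) (vertices u es) ≡⟨ cong (count (adj G v)) (sources p) ⟨
      count (adj G v) (map proj₁ es ++ [ v ]) ≡⟨ sumOver-++ _ (map proj₁ es) [ v ] ⟩
      count (adj G v) (map proj₁ es) + (indicator (adj G v v) + 0)
        ≡⟨ cong₂ (λ a b → a + (indicator b + 0)) (sumOver-∘ _ proj₁ es) (irrefl G v) ⟩
      count (adj G v ∘ proj₁) es + 0 ≡⟨ +-identityʳ _ ⟩
      count (adj G v ∘ proj₁) es ∎
      where open ≤-Reasoning

    start-degree : ¬ (∃ λ w → w ∈ S × Outside (vertices u es) u w) →
      degree S u ≤ count (adj G u ∘ proj₂) es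
    start-degree none = begin
      degree S u ≤⟨ count-⊆ (adj G u) (adj G u) uS (λ w∈ a → closed none w∈ a , a) ⟩
      count (adj G u) (vertices u es) ≡⟨ cong₂ (λ b a → indicator b + a) (irrefl G u) (sumOver-∘ _ proj₂ es) ⟩
      count (adj G u ∘ proj₂) es ∎
      where open ≤-Reasoning

    by-cases : Dec (∃ λ t → t ∈ vertices u es × ∃ λ w → w ∈ S × Outside (vertices u es) t w) →
      Dec (∃ λ w → w ∈ S × Outside (vertices u es) u w) →
      Dec (∃ λ w → w ∈ S × Outside (vertices u es) v w) →
      PathIn Any-colours S (suc k) ⊎ Peelable (l ∸ 1) S
    -- No edge within `S` leaves the path, and its `k + 1` vertices number at most `l`, one more
    -- than the peeling constant.
    by-cases (no none) _ _ = inj₂ (peel-closed (l ∸ 1) uS uq (s≤s z≤n)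
      (subst (_≤ suc (l ∸ 1)) (sym |vs|) (≤-trans k<l (m≤n+m∸n l 1))) sub
      (λ t∈ → closed (λ out → none (_ , t∈ , out))))
    by-cases (yes _) (yes (w , w∈ , w∉ , a)) _ = inj₁ (longer (pathFrom p Perm.refl Perm.refl) w∈ w∉ a)
    by-cases (yes _) (no _) (yes (w , w∈ , w∉ , a)) = inj₁ (longer (reverse p) w∈ w∉ a)
    by-cases (yes (t , t∈ , w , w∈ , w∉ , a)) (no noneᵤ) (no noneᵥ)
      -- The degrees of the two ends sum to at least `l`, which exceeds the number `k` of steps.
      with count-pigeonhole (adj G v ∘ proj₁) (adj G u ∘ proj₂) es (begin-strict
        length es ≡⟨ len ⟩
        k <⟨ k<l ⟩
        l ≤⟨ *-cancelˡ-≤ 2 (begin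
          2 * l ≡⟨ cong (l +_) (+-identityʳ l) ⟩
          l + l ≤⟨ +-mono-≤ (deg (sub (finish∈ p))) (deg (sub (here refl))) ⟩
          2 * degree S v + 2 * degree S u ≡⟨ *-distribˡ-+ 2 (degree S v) _ ⟨
          2 * (degree S v + degree S u) ∎) ⟩
        degree S v + degree S u ≤⟨ +-mono-≤ (finish-degree noneᵥ) (start-degree noneᵤ) ⟩
        _ ∎)
      where open ≤-Reasoning
    ... | (y , z) , e∈ , vy , uz with ∈-∃++ e∈
    -- The rotated path runs from `v` to `y`, and the edge `vy` closes it to a cycle on the same
    -- vertices. The cycle is opened at `t`, so that the edge `tw` can be attached.
    ...   | es₁ , es₂ , refl with rotate es₁ p (adj⇄ uz)
    ...     | es″ , q , qv , _ with around-cycle q (adj⇄ vy) (Perm.∈-resp-↭ (↭-sym qv) t∈)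
    ...       | _ , pathFrom r rv rc = inj₁ (longer (pathFrom r (↭-trans rv qv) rc) w∈ w∉ a)

  -- Lengthening a rainbow path

  Fresh : List V → List ℕ → V → V → Set
  Fresh vs cs x w = w ∉ vs × Adj x w × col c x w ∉ cs

  fresh? : ∀ S vs cs x → Dec (∃ λ w → w ∈ S × Fresh vs cs x w)
  fresh? S vs cs x = ∃∈? (λ w → ¬? (w ∈? vs) ×-dec Adj? x w ×-dec ¬? (col c x w ∈ᶜ? cs)) S

  rainbow-longer : ∀ {S k} → Unique S → (∀ {v} → v ∈ S → 3 * suc k ≤ 2 * degree S v) →
    PathIn Unique S k → PathIn Unique S (suc k)
  rainbow-longer {S} {k} uS deg
    record { start = u ; finish = v ; steps = es ; path = p ; distinct = uq ; within = sub ; admissible = uc ; length≡ = len }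
    = by-cases (fresh? S W C u) (fresh? S W C v)
    where
    W = vertices u es
    C = colours es

    |W| : length W ≡ suc k
    |W| = trans (length-vertices u es) (cong suc len)

    |C| : length C ≡ k
    |C| = trans (length-map _ es) len

    longer : ∀ {cs′} → PathFrom x W cs′ → w ∈ S → w ∉ W → Adj x w → Unique (col c w x ∷ cs′) → PathIn Unique S (suc k)
    longer f w∈ w∉ a = lengthen Unique-resp-↭ f uq sub |W| w∈ w∉ a

    longer-fresh : PathFrom x W C → (∃ λ w → w ∈ S × Fresh W C x w) → PathIn Unique S (suc k)
    longer-fresh {x} f (w , w∈ , w∉ , a , new) =
      longer f w∈ w∉ a (¬Any⇒All¬ C (new ∘ subst (_∈ C) (sym (colSym c x w a))) ∷ uc)

    -- A condition on a colour, not on a vertex: the edges leaving at `v` are counted through their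
    -- colours, and these through the steps that carry them.
    escape? : ∀ γ → Dec (∃ λ w → w ∈ S × (w ∉ W × Adj v w × col c v w ≡ γ))
    escape? γ = ∃∈? (λ w → ¬? (w ∈? W) ×-dec Adj? v w ×-dec (col c v w ℕ.≟ γ)) S

    escapes : ℕ → Bool
    escapes γ = does (escape? γ)

    escaping : Step → Bool
    escaping (x , y) = escapes (col c x y)

    chord : V → Bool
    chord z = adj G u z ∧ not (does (col c u z ∈ᶜ? C))

    -- At most `k + 1` neighbours lie on the path. Edges to the others repeat path colours, by
    -- `none`, and have distinct colours by properness.
    finish-degree : ¬ (∃ λ w → w ∈ S × Fresh W C v w) → degree S v ≤ suc k + count escaping es
    finish-degree none = begin
      degree S v ≡⟨ count-split (adj G v) (λ w → does (w ∈? W)) S ⟩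
      count (λ w → adj G v w ∧ does (w ∈? W)) S + count (λ w → adj G v w ∧ not (does (w ∈? W))) S
        ≤⟨ +-mono-≤ inside outside ⟩
      suc k + count escapes C ≡⟨ cong (suc k +_) (sumOver-∘ _ _ es) ⟩
      suc k + count escaping es ∎
      where
      open ≤-Reasoning
      inside : count (λ w → adj G v w ∧ does (w ∈? W)) S ≤ suc k
      inside = ≤-trans
        (count-⊆ _ (λ _ → true) uS (λ {w} _ e → does-true (w ∈? W) (proj₂ (∧-true e)) , refl))
        (≤-trans (count≤length _ W) (≤-reflexive |W|))
      outside : count (λ w → adj G v w ∧ not (does (w ∈? W))) S ≤ count escapes C
      outside = count-injection (col c v) _ escapes uS
        (λ {w} w∈ e → let a , o = ∧-true e ; w∉ = does-not (w ∈? W) o in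
          decidable-stable (col c v w ∈ᶜ? C) (λ new → none (w , w∈ , w∉ , a , new))
          , dec-true (escape? (col c v w)) (w , w∈ , w∉ , a , refl))
        (λ _ _ e e′ → colour-injective (proj₁ (∧-true e)) (proj₁ (∧-true e′)))

    -- Here the split is by colour: properness allows at most `k` edges at `u` with path colours,
    -- and by `none` the other edges end on the path, at targets of steps.
    start-degree : ¬ (∃ λ w → w ∈ S × Fresh W C u w) → degree S u ≤ k + count (chord ∘ proj₂) es
    start-degree none = begin
      degree S u ≡⟨ count-split (adj G u) (λ z → does (col c u z ∈ᶜ? C)) S ⟩
      count (λ z → adj G u z ∧ does (col c u z ∈ᶜ? C)) S + count chord S
        ≤⟨ +-mono-≤ old new ⟩
      k + count (chord ∘ proj₂) es ∎
      where
      open ≤-Reasoning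
      old : count (λ z → adj G u z ∧ does (col c u z ∈ᶜ? C)) S ≤ k
      old = ≤-trans
        (count-injection (col c u) _ (λ _ → true) uS
          (λ {z} _ e → does-true (col c u z ∈ᶜ? C) (proj₂ (∧-true e)) , refl)
          (λ _ _ e e′ → colour-injective (proj₁ (∧-true e)) (proj₁ (∧-true e′))))
        (≤-trans (count≤length _ C) (≤-reflexive |C|))
      new : count chord S ≤ count (chord ∘ proj₂) es
      new = ≤-trans
        (count-⊆ chord chord uS (λ {z} z∈ e → let a , o = ∧-true e in
          decidable-stable (z ∈? W) (λ z∉ → none (z , z∈ , z∉ , a , does-not (col c u z ∈ᶜ? C) o)) , e))
        (≤-reflexive (cong₂ (λ b m → indicator (b ∧ not (does (col c u u ∈ᶜ? C))) + m) (irrefl G u) (sumOver-∘ _ proj₂ es)))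

    -- The degrees sum to at least 3k + 3. The terms k + 1 and k of the two estimates leave at least
    -- k + 2 for the counted steps.
    arith : ∀ α β → 3 * suc k ≤ (suc k + α) + (k + β) → k < α + β
    arith α β h = <⇒≤ (+-cancelˡ-≤ (suc (k + k)) _ _ (subst₂ _≤_ (lhs k) (rhs k α β) h))
      where
      lhs : ∀ k → 3 * suc k ≡ suc (k + k) + suc (suc k)
      lhs = solve-∀
      rhs : ∀ k α β → (suc k + α) + (k + β) ≡ suc (k + k) + (α + β)
      rhs = solve-∀

    by-cases : Dec (∃ λ w → w ∈ S × Fresh W C u w) → Dec (∃ λ w → w ∈ S × Fresh W C v w) → PathIn Unique S (suc k)
    by-cases (yes f) _ = longer-fresh (pathFrom p Perm.refl Perm.refl) f
    by-cases (no _) (yes f) = longer-fresh (reverse p) f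
    by-cases (no noneᵤ) (no noneᵥ)
      with count-pigeonhole escaping (chord ∘ proj₂) es (subst (_< count escaping es + count (chord ∘ proj₂) es) (sym len)
          (arith (count escaping es) (count (chord ∘ proj₂) es) (begin
        3 * suc k ≤⟨ *-cancelˡ-≤ 2 (begin
          2 * (3 * suc k) ≡⟨ cong (3 * suc k +_) (+-identityʳ _) ⟩
          3 * suc k + 3 * suc k ≤⟨ +-mono-≤ (deg (sub (finish∈ p))) (deg (sub (here refl))) ⟩
          2 * degree S v + 2 * degree S u ≡⟨ *-distribˡ-+ 2 (degree S v) _ ⟨
          2 * (degree S v + degree S u) ∎) ⟩
        degree S v + degree S u ≤⟨ +-mono-≤ (finish-degree noneᵥ) (start-degree noneᵤ) ⟩
        _ ∎)))
      where open ≤-Reasoning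
    ... | (y , z) , e∈ , esc , ch with does-true (escape? (col c y z)) esc | ∧-true {adj G u z} ch | ∈-∃++ e∈
    ...   | w , w∈ , w∉ , vw , same | uz , new | es₁ , es₂ , refl with rotate es₁ p (adj⇄ uz)
    -- The rotation exchanges the colour of `yz` for the new colour of `uz`; this frees the colour
    -- of `yz` for the edge `vw`.
    ...     | es″ , q , qv , qc = longer (pathFrom q qv qc) w∈ w∉ vw
        (Unique-resp-↭ (↭-sym rainbow↭) (¬Any⇒All¬ C (does-not (col c u z ∈ᶜ? C) new ∘ subst (_∈ C) (sym (colSym c u z uz))) ∷ uc))
      where
      rainbow↭ : col c w v ∷ col c z u ∷ colours es₁ ++ colours es₂ ↭ col c z u ∷ C
      rainbow↭ = ↭-trans (↭-reflexive (cong (_∷ col c z u ∷ colours es₁ ++ colours es₂) (trans (sym (colSym c v w vw)) same)))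
        (↭-trans (swap _ _ Perm.refl)
          (prep _ (↭-trans (↭-sym (Perm.shift _ (colours es₁) (colours es₂))) (↭-reflexive (sym (map-++ _ es₁ _))))))

  -- From large degrees to long paths or peelable sets

  grow-or-peel : ∀ {S} l → Unique S → 0 < length S → (∀ {v} → v ∈ S → l ≤ 2 * degree S v) →
    ∀ k → k ≤ l → PathIn Any-colours S k ⊎ Peelable (l ∸ 1) S
  grow-or-peel l uS S>0 deg zero _ = inj₁ (trivial-path tt S>0)
  grow-or-peel l uS S>0 deg (suc k) k<l with grow-or-peel l uS S>0 deg k (<⇒≤ k<l)
  ... | inj₁ p = longer-or-peelable l uS deg k<l p
  ... | inj₂ q = inj₂ q

  grow-rainbow : ∀ {S} l → Unique S → 0 < length S → (∀ {v} → v ∈ S → 3 * l ≤ 2 * degree S v) →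
    ∀ k → k ≤ l → PathIn Unique S k
  grow-rainbow l uS S>0 deg zero _ = trivial-path [] S>0
  grow-rainbow l uS S>0 deg (suc k) k<l =
    -- The degree required at stage `k` grows with `k`; the threshold `3 * l` covers all stages.
    rainbow-longer uS (λ v∈ → ≤-trans (*-monoʳ-≤ 3 k<l) (deg v∈)) (grow-rainbow l uS S>0 deg k (<⇒≤ k<l))

  -- Without a vertex to peel, every vertex has twice its degree at least `l`. Growing then reaches
  -- `l` steps, which is forbidden, or meets a peelable set.
  path-free-peelable : ∀ l → 1 ≤ l → PathFree G l → ∀ {S} → Unique S → 0 < length S → Peelable (l ∸ 1) S
  path-free-peelable l l≥1 free {S} uS S>0 with ∃∈? (λ v → 2 * degree S v ≤? l ∸ 1) S
  ... | yes (v , v∈ , d≤) = peel-vertex (l ∸ 1) v∈ d≤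
  ... | no none with grow-or-peel l uS S>0
        (λ v∈ → ≤-trans (≤-reflexive (sym (m+[n∸m]≡n l≥1))) (≰⇒> (λ d≤ → none (_ , v∈ , d≤)))) l ≤-refl
  ...   | inj₁ p = ⊥-elim (free (copy p))
  ...   | inj₂ q = q

  -- The condition on `d` says that degree `d + 1` meets the threshold of `grow-rainbow`, so some
  -- vertex has degree at most `d`.
  rainbow-free-peelable : ∀ l d → 3 * l ≤ 2 * suc d → (∀ (p : PathCopy G l) → ¬ Rainbow c p) →
    ∀ {S} → Unique S → 0 < length S → Peelable (2 * d) S
  rainbow-free-peelable l d l≤d free {S} uS S>0 with ∃∈? (λ v → degree S v ≤? d) S
  ... | yes (v , v∈ , d≤) = peel-vertex (2 * d) v∈ (*-monoʳ-≤ 2 d≤)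
  ... | no none = ⊥-elim (free (copy p) (rainbow-copy p))
    where
    p : PathIn Unique S l
    p = grow-rainbow l uS S>0 (λ v∈ → ≤-trans l≤d (*-monoʳ-≤ 2 (≰⇒> (λ d≤ → none (_ , v∈ , d≤))))) l ≤-refl

-- Upper bounds on the number of edges

module _ {n : ℕ} (G : Graph n) where
  open Degrees G

  peelable-edges : ∀ k → (∀ {S} → Unique S → 0 < length S → Peelable k S) → 2 * edges G ≤ k * n
  peelable-edges k step = begin
    2 * edges G ≡⟨ handshake ⟩
    between (allFin n) (allFin n) ≤⟨ peel k step _ ≤-refl (Unique.allFin⁺ n) ⟩
    k * length (allFin n) ≡⟨ cong (k *_) (length-tabulate id) ⟩
    k * n ∎
    where
    open ≤-Reasoning

-- A proper colouring of an arbitrary graph. It turns path-free graphs into rainbow-path-free ones,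
-- and lets the uncoloured bound be drawn from `Paths`.
sum-colouring : ∀ {n} (G : Graph n) → ProperColouring G
sum-colouring G = record
  { col = λ u v → toℕ u + toℕ v
  ; colSym = λ u v _ → +-comm (toℕ u) (toℕ v)
  ; proper = λ u v w _ _ v≢w e → v≢w (toℕ-injective (+-cancelˡ-≡ (toℕ u) _ _ e))
  }

path-free⇒rainbow-path-free : ∀ {n} (G : Graph n) l → PathFree G l → RainbowPathFree G l
path-free⇒rainbow-path-free G l free = sum-colouring G , λ p _ → free p

path-free-edges : ∀ {n} (G : Graph n) l → 1 ≤ l → PathFree G l → 2 * edges G ≤ (l ∸ 1) * n
path-free-edges G l l≥1 free = peelable-edges G (l ∸ 1) (path-free-peelable l l≥1 free)
  where open Paths (sum-colouring G)

n≤2*⌈n/2⌉ : ∀ n → n ≤ 2 * ⌈ n /2⌉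
n≤2*⌈n/2⌉ n = begin
  n ≡⟨ ⌊n/2⌋+⌈n/2⌉≡n n ⟨
  ⌊ n /2⌋ + ⌈ n /2⌉ ≤⟨ +-monoˡ-≤ ⌈ n /2⌉ (⌊n/2⌋≤⌈n/2⌉ n) ⟩
  ⌈ n /2⌉ + ⌈ n /2⌉ ≡⟨ cong (⌈ n /2⌉ +_) (+-identityʳ _) ⟨
  2 * ⌈ n /2⌉ ∎
  where open ≤-Reasoning

rainbow-path-free-edges : ∀ {n} (G : Graph n) l → RainbowPathFree G l → edges G ≤ ⌈ 3 * l ∸ 2 /2⌉ * n
rainbow-path-free-edges {n} G l (c , free) = *-cancelˡ-≤ 2 (begin
  2 * edges G ≤⟨ peelable-edges G (2 * d) (rainbow-free-peelable l d l≤d free) ⟩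
  2 * d * n ≡⟨ *-assoc 2 d n ⟩
  2 * (d * n) ∎)
  where
  open ≤-Reasoning
  open Paths c
  d = ⌈ 3 * l ∸ 2 /2⌉
  -- This is where the constant of the theorem comes from: `d` is the least number with this
  -- property when `l` is positive.
  l≤d : 3 * l ≤ 2 * suc d
  l≤d = begin
    3 * l ≤⟨ m≤n+m∸n (3 * l) 2 ⟩
    2 + (3 * l ∸ 2) ≤⟨ +-monoʳ-≤ 2 (n≤2*⌈n/2⌉ (3 * l ∸ 2)) ⟩
    2 + 2 * d ≡⟨ *-suc 2 d ⟨
    2 * suc d ∎

-- Disjoint cliques

sumOver-allFin : ∀ {n} (f : Fin (suc n) → ℕ) → sumOver f (allFin (suc n)) ≡ f zero + sumOver (f ∘ suc) (allFin n)
sumOver-allFin {n} f = cong (λ xs → f zero + sum xs) (trans (map-tabulate suc f) (sym (map-tabulate id (f ∘ suc))))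

constant-along : ∀ {k} {A : Set} (f : Fin (suc k) → A) → (∀ i → f (inject₁ i) ≡ f (suc i)) → ∀ i → f i ≡ f zero
constant-along f h zero = refl
constant-along {suc k} f h (suc i) = trans (constant-along (f ∘ suc) (h ∘ suc) i) (sym (h zero))

module Cliques (l : ℕ) .{{_ : NonZero l}} where

  same-block? : ∀ {n} (i j : Fin n) → Dec (toℕ i / l ≡ toℕ j / l)
  same-block? i j = toℕ i / l ℕ.≟ toℕ j / l

  -- The blocks are runs of `l` consecutive vertices, told apart by the quotient by `l`; the last
  -- block may be shorter.
  cliques : ∀ n → Graph n
  cliques n = record
    { adj = λ i j → does (same-block? i j) ∧ not (does (i ≟ j))
    ; sym = λ i j → cong₂ (λ a b → a ∧ not b)
        (does-⇔ (mk⇔ sym sym) (same-block? i j) (same-block? j i)) (does-⇔ (mk⇔ sym sym) (i ≟ j) (j ≟ i))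
    ; irrefl = λ i → trans (cong (λ b → does (same-block? i i) ∧ not b) (dec-true (i ≟ i) refl)) (Bool.∧-zeroʳ _)
    }

  -- A path stays in one block. Two of its `l + 1` vertices share a residue modulo `l`, and with
  -- equal quotients they coincide.
  cliques-path-free : ∀ n → PathFree (cliques n) l
  cliques-path-free n p with pigeonhole ≤-refl (λ i → fromℕ< (m%n<n (toℕ (vtx p i)) l))
  ... | i , j , i<j , same = <⇒≢ i<j (cong toℕ (inj p (toℕ-injective (begin
    toℕ (vtx p i)                                    ≡⟨ m≡m%n+[m/n]*n _ l ⟩
    toℕ (vtx p i) % l + toℕ (vtx p i) / l * l        ≡⟨ cong₂ (λ r q → r + q * l) residue (trans (block i) (sym (block j))) ⟩
    toℕ (vtx p j) % l + toℕ (vtx p j) / l * l        ≡⟨ m≡m%n+[m/n]*n _ l ⟨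
    toℕ (vtx p j)                                    ∎))))
    where
    open ≡-Reasoning
    block : ∀ i → toℕ (vtx p i) / l ≡ toℕ (vtx p zero) / l
    block = constant-along (λ i → toℕ (vtx p i) / l)
      (λ i → does-true (same-block? (vtx p (inject₁ i)) (vtx p (suc i))) (proj₁ (∧-true (isEdge p i))))
    residue : toℕ (vtx p i) % l ≡ toℕ (vtx p j) % l
    residue = trans (sym (toℕ-fromℕ< (m%n<n _ l))) (trans (cong toℕ same) (toℕ-fromℕ< (m%n<n _ l)))

  -- The smaller neighbours of `i` include the vertices of its block with smaller residue, obtained
  -- by adding each `t` below the residue of `i` to the start of the block.
  clique-row : ∀ {n} (i : Fin n) → toℕ i % l ≤ count (λ j → (toℕ j <ᵇ toℕ i) ∧ adj (cliques n) i j) (allFin n)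
  clique-row {n} i = begin
    r ≡⟨ length-tabulate id ⟨
    length (allFin r) ≡⟨ trans (sumOver-const 1 (allFin r)) (*-identityˡ _) ⟨
    count (λ _ → true) (allFin r) ≤⟨ count-injection below (λ _ → true) (λ j → (toℕ j <ᵇ toℕ i) ∧ adj (cliques n) i j)
      (Unique.allFin⁺ r)
      (λ {t} _ _ → ∈-allFin (below t) , edge t)
      (λ {s} {t} _ _ _ _ e → toℕ-injective (+-cancelˡ-≡ (q * l) _ _ (trans (sym (toℕ-below s)) (trans (cong toℕ e) (toℕ-below t))))) ⟩
    count (λ j → (toℕ j <ᵇ toℕ i) ∧ adj (cliques n) i j) (allFin n) ∎
    where
    open ≤-Reasoning
    r = toℕ i % l
    q = toℕ i / l
    bound : (t : Fin r) → q * l + toℕ t < toℕ i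
    bound t = begin-strict
      q * l + toℕ t <⟨ +-monoʳ-< (q * l) (toℕ<n t) ⟩
      q * l + r ≡⟨ +-comm (q * l) r ⟩
      r + q * l ≡⟨ m≡m%n+[m/n]*n (toℕ i) l ⟨
      toℕ i ∎
    below : Fin r → Fin n
    below t = fromℕ< (<-trans (bound t) (toℕ<n i))
    toℕ-below : ∀ t → toℕ (below t) ≡ q * l + toℕ t
    toℕ-below t = toℕ-fromℕ< _
    below< : ∀ t → toℕ (below t) < toℕ i
    below< t = subst (_< toℕ i) (sym (toℕ-below t)) (bound t)
    block : ∀ t → toℕ i / l ≡ toℕ (below t) / l
    block t = sym (begin-equality
      toℕ (below t) / l ≡⟨ cong (_/ l) (toℕ-below t) ⟩
      (q * l + toℕ t) / l ≡⟨ +-distrib-/-∣ˡ (toℕ t) (n∣m*n q) ⟩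
      q * l / l + toℕ t / l ≡⟨ cong₂ _+_ (m*n/n≡m q l) (m<n⇒m/n≡0 (<-trans (toℕ<n t) (m%n<n (toℕ i) l))) ⟩
      q + 0 ≡⟨ +-identityʳ q ⟩
      q ∎)
    edge : ∀ t → ((toℕ (below t) <ᵇ toℕ i) ∧ adj (cliques n) i (below t)) ≡ true
    edge t = cong₂ _∧_ (Bool.T-≡ .Equivalence.to (<⇒<ᵇ (below< t)))
      (cong₂ (λ a b → a ∧ not b) (dec-true (same-block? i (below t)) (block t))
        (dec-false (i ≟ below t) (λ e → <-irrefl (cong toℕ (sym e)) (below< t))))

  -- The number of missing edge-ends when the last block of n vertices has n % l of its l vertices.
  deficit : ℕ → ℕ
  deficit n = n % l * (l ∸ n % l)

  %-suc : ∀ a → (suc (a % l) < l × suc a % l ≡ suc (a % l)) ⊎ (suc (a % l) ≡ l × suc a % l ≡ 0)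
  %-suc a with m≤n⇒m<n∨m≡n (m%n<n a l)
  ... | inj₁ lt = inj₁ (lt , trans suc-a%l (m<n⇒m%n≡m lt))
    where
    suc-a%l : suc a % l ≡ suc (a % l) % l
    suc-a%l = trans (cong (λ b → suc b % l) (m≡m%n+[m/n]*n a l)) ([m+kn]%n≡m%n (suc (a % l)) (a / l) l)
  ... | inj₂ eq = inj₂ (eq , trans (cong (λ b → suc b % l) (m≡m%n+[m/n]*n a l))
      (trans ([m+kn]%n≡m%n (suc (a % l)) (a / l) l) (trans (cong (_% l) eq) (n%n≡0 l))))

  -- With r the residue of `a`, this is 2r + (r + 1)(l - r - 1) = (l - 1) + r(l - r). When r + 1 = l
  -- the second product is zero, in accordance with the residue returning to 0.
  deficit-suc : ∀ a → 2 * (a % l) + deficit (suc a) ≡ (l ∸ 1) + deficit a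
  deficit-suc a with %-suc a
  ... | inj₂ (eq , z) rewrite z = goal (a % l) l eq
    where
    goal : ∀ r l → suc r ≡ l → 2 * r + 0 ≡ (l ∸ 1) + r * (l ∸ r)
    goal r .(suc r) refl rewrite m+n∸n≡m 1 r = lem r
      where
      lem : ∀ r → 2 * r + 0 ≡ r + r * 1
      lem = solve-∀
  ... | inj₁ (lt , z) rewrite z with m≤n⇒∃[o]m+o≡n lt
  ...   | o , e = goal (a % l) o l e
    where
    goal : ∀ r o l → suc (suc r) + o ≡ l → 2 * r + suc r * (l ∸ suc r) ≡ (l ∸ 1) + r * (l ∸ r)
    goal r o .(suc (suc r) + o) refl
      rewrite trans (cong (_∸ r) (sym (+-suc r o))) (m+n∸m≡n r (suc o))
            | trans (cong (_∸ r) (trans (cong suc (sym (+-suc r o))) (sym (+-suc r (suc o))))) (m+n∸m≡n r (suc (suc o))) = lem r o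
      where
      lem : ∀ r o → 2 * r + suc r * suc o ≡ suc (r + o) + r * suc (suc o)
      lem = solve-∀

  -- `deficit-suc` telescopes. The offset `a` is there for the induction: splitting off the first
  -- vertex shifts all the others by one.
  sum-residues : ∀ n a → 2 * sumOver (λ i → (a + toℕ i) % l) (allFin n) + deficit (a + n) ≡ (l ∸ 1) * n + deficit a
  sum-residues zero a = trans (cong deficit (+-identityʳ a)) (cong (_+ deficit a) (sym (*-zeroʳ (l ∸ 1))))
  sum-residues (suc n) a = begin
    2 * sumOver (λ i → (a + toℕ i) % l) (allFin (suc n)) + deficit (a + suc n)
      ≡⟨ cong₂ (λ s b → 2 * s + deficit b) (sumOver-allFin {n} (λ i → (a + toℕ i) % l)) (+-suc a n) ⟩
    2 * ((a + 0) % l + sumOver (λ i → (a + suc (toℕ i)) % l) (allFin n)) + deficit (suc a + n)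
      ≡⟨ cong₂ (λ b s → 2 * (b % l + s) + deficit (suc a + n)) (+-identityʳ a)
           (sumOver-cong (λ i → cong (_% l) (+-suc a (toℕ i))) (allFin n)) ⟩
    2 * (a % l + s′) + deficit (suc a + n) ≡⟨ regroup (a % l) s′ (deficit (suc a + n)) ⟩
    2 * (a % l) + (2 * s′ + deficit (suc a + n)) ≡⟨ cong (2 * (a % l) +_) (sum-residues n (suc a)) ⟩
    2 * (a % l) + ((l ∸ 1) * n + deficit (suc a)) ≡⟨ swap₁ (2 * (a % l)) ((l ∸ 1) * n) (deficit (suc a)) ⟩
    (l ∸ 1) * n + (2 * (a % l) + deficit (suc a)) ≡⟨ cong ((l ∸ 1) * n +_) (deficit-suc a) ⟩
    (l ∸ 1) * n + ((l ∸ 1) + deficit a) ≡⟨ swap₂ (l ∸ 1) n (deficit a) ⟩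
    (l ∸ 1) * suc n + deficit a ∎
    where
    open ≡-Reasoning
    s′ = sumOver (λ i → (suc a + toℕ i) % l) (allFin n)
    regroup : ∀ x y z → 2 * (x + y) + z ≡ 2 * x + (2 * y + z)
    regroup = solve-∀
    swap₁ : ∀ x y z → x + (y + z) ≡ y + (x + z)
    swap₁ = solve-∀
    swap₂ : ∀ x n z → x * n + (x + z) ≡ x * suc n + z
    swap₂ = solve-∀

  -- The crude bound `l * l` on the deficit is independent of `n`, hence negligible in the
  -- asymptotics.
  cliques-edges : ∀ n → (l ∸ 1) * n ≤ 2 * edges (cliques n) + l * l
  cliques-edges n = begin
    (l ∸ 1) * n ≤⟨ m≤m+n _ (deficit 0) ⟩
    (l ∸ 1) * n + deficit 0 ≡⟨ sum-residues n 0 ⟨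
    2 * sumOver (λ i → toℕ i % l) (allFin n) + deficit n
      ≤⟨ +-mono-≤ (*-monoʳ-≤ 2 (sumOver-mono (allFin n) (λ {i} _ → clique-row i)))
                  (*-mono-≤ (<⇒≤ (m%n<n n l)) (m∸n≤m l (n % l))) ⟩
    2 * edges (cliques n) + l * l ∎
    where open ≤-Reasoning

-- Existence of the extremal numbers

-- Functions between finite sets are coded by numbers, so existential statements about them are decidable.
∃-function? : ∀ {a b} {P : (Fin a → Fin b) → Set} → (∀ f → Dec (P f)) → (∀ {f g} → f ≗ g → P f → P g) → Dec (∃ P)
∃-function? {a} {b} P? resp = map′ (λ (x , px) → finToFun x , px)
  (λ (f , pf) → funToFin f , resp (λ i → sym (finToFun-funToFin f i)) pf) (any? {b ^ a} (P? ∘ finToFun))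

-- Each row is coded by one number, which reduces matrices to functions. `resp` is required because
-- decoding a code returns the entries only pointwise.
∃-matrix? : ∀ {a b k} {P : (Fin a → Fin b → Fin k) → Set} → (∀ f → Dec (P f)) →
  (∀ {f g} → (∀ i j → f i j ≡ g i j) → P f → P g) → Dec (∃ P)
∃-matrix? {a} {b} {k} P? resp = map′
  (λ (x , px) → (λ i → finToFun (x i)) , px)
  (λ (f , pf) → (λ i → funToFin (f i)) , resp (λ i j → sym (finToFun-funToFin (f i) j)) pf)
  (∃-function? {a} {k ^ b} (λ x → P? (λ i → finToFun (x i))) (λ e → resp (λ i j → cong (λ y → finToFun y j) (e i))))

-- Only finitely many colours occur; each is renamed to an index at which it occurs.
module Renaming {k : ℕ} (at : Fin k → ℕ) where

  occurrence? : ∀ γ → Dec (∃ λ x → at x ≡ γ)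
  occurrence? γ = any? (λ x → at x ℕ.≟ γ)

  index : ∀ {γ} → Dec (∃ λ x → at x ≡ γ) → Fin (suc k)
  index (yes (x , _)) = suc x
  index (no _) = zero

  index-injective : ∀ {γ δ} (p : Dec (∃ λ x → at x ≡ γ)) (q : Dec (∃ λ x → at x ≡ δ)) →
    (∃ λ x → at x ≡ γ) → index p ≡ index q → γ ≡ δ
  index-injective (yes (_ , e)) (yes (_ , refl)) _ refl = sym e
  index-injective (no none) _ some _ = ⊥-elim (none some)

  rename : ℕ → Fin (suc k)
  rename γ = index (occurrence? γ)

  rename-injective : ∀ {γ δ} → (∃ λ x → at x ≡ γ) → rename γ ≡ rename δ → γ ≡ δ
  rename-injective {γ} {δ} = index-injective (occurrence? γ) (occurrence? δ)

module _ {n : ℕ} where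
  private V = Fin n

  _≈_ : Graph n → Graph n → Set
  G ≈ H = ∀ i j → adj G i j ≡ adj H i j

  edges-cong : ∀ {G H} → G ≈ H → edges G ≡ edges H
  edges-cong e = sumOver-cong (λ i → sumOver-cong (λ j → cong (λ b → indicator ((toℕ j <ᵇ toℕ i) ∧ b)) (e i j)) (allFin n)) (allFin n)

  path-cong : ∀ {G H l} → G ≈ H → PathCopy G l → PathCopy H l
  path-cong e p = record { vtx = vtx p ; inj = inj p ; isEdge = λ i → trans (sym (e _ _)) (isEdge p i) }

  -- Every matrix yields a graph: an edge needs both symmetric entries, and the diagonal is cleared.
  -- So a search over matrices reaches all graphs up to `≈`.
  fromMatrix : (V → V → Fin 2) → Graph n
  fromMatrix M = record
    { adj = λ i j → (entry i j ∧ entry j i) ∧ not (does (i ≟ j))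
    ; sym = λ i j → cong₂ (λ a b → a ∧ not b) (Bool.∧-comm (entry i j) (entry j i)) (does-⇔ (mk⇔ sym sym) (i ≟ j) (j ≟ i))
    ; irrefl = λ i → trans (cong (λ b → (entry i i ∧ entry i i) ∧ not b) (dec-true (i ≟ i) refl)) (Bool.∧-zeroʳ _)
    }
    where
    entry : V → V → Bool
    entry i j = does (M i j ≟ zero)

  toMatrix : Graph n → V → V → Fin 2
  toMatrix G i j = if adj G i j then zero else suc zero

  fromMatrix-cong : ∀ {M N} → (∀ i j → M i j ≡ N i j) → fromMatrix M ≈ fromMatrix N
  fromMatrix-cong e i j = cong₂ (λ a b → (does (a ≟ zero) ∧ does (b ≟ zero)) ∧ not (does (i ≟ j))) (e i j) (e j i)

  fromMatrix-toMatrix : ∀ G → G ≈ fromMatrix (toMatrix G)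
  fromMatrix-toMatrix G i j rewrite adj-sym G j i with adj G i j in a | i ≟ j
  ... | false | _ = refl
  ... | true | no _ = refl
  ... | true | yes refl = trans (sym a) (irrefl G i)

  ∃-graph? : {P : Graph n → Set} → (∀ G → Dec (P G)) → (∀ {G H} → G ≈ H → P G → P H) → Dec (∃ P)
  ∃-graph? P? resp = map′ (λ (M , p) → fromMatrix M , p) (λ (G , p) → toMatrix G , resp (fromMatrix-toMatrix G) p)
    (∃-matrix? (P? ∘ fromMatrix) (λ e → resp (fromMatrix-cong e)))

  IsMaximum : (Graph n → Set) → ℕ → Set
  IsMaximum P m = (Σ (Graph n) λ G → P G × edges G ≡ m) × (∀ G → P G → edges G ≤ m)

  -- Downward search from the bound: either it is attained, or it can be lowered by one. At zero the
  -- given graph attains it.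
  maximum : {P : Graph n → Set} → (∀ G → Dec (P G)) → (∀ {G H} → G ≈ H → P G → P H) → ∃ P →
    ∀ b → (∀ G → P G → edges G ≤ b) → ∃ (IsMaximum P)
  maximum P? resp (G , p) zero bound = 0 , (G , p , n≤0⇒n≡0 (bound G p)) , bound
  maximum P? resp w (suc b) bound
    with ∃-graph? (λ G → P? G ×-dec (edges G ℕ.≟ suc b)) (λ {G} {H} e (p , q) → resp e p , trans (sym (edges-cong {G} {H} e)) q)
  ... | yes attained = suc b , attained , bound
  ... | no ¬attained = maximum P? resp w b (λ G p → ≤-pred (≤∧≢⇒< (bound G p) (λ e → ¬attained (G , p , e))))

  module _ (G : Graph n) (l : ℕ) where

    IsPath : (Fin (suc l) → V) → Set
    IsPath f = (∀ i j → f i ≡ f j → i ≡ j) × (∀ i → adj G (f (inject₁ i)) (f (suc i)) ≡ true)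

    IsPath? : ∀ f → Dec (IsPath f)
    IsPath? f = all? (λ i → all? λ j → (f i ≟ f j) →-dec (i ≟ j)) ×-dec all? (λ i → adj G (f (inject₁ i)) (f (suc i)) Bool.≟ true)

    IsPath-cong : ∀ {f g} → f ≗ g → IsPath f → IsPath g
    IsPath-cong e (injective , edge) = (λ i j q → injective i j (trans (e i) (trans q (sym (e j)))))
      , λ i → trans (sym (cong₂ (adj G) (e (inject₁ i)) (e (suc i)))) (edge i)

    path-free? : Dec (PathFree G l)
    path-free? = ¬? (map′ (λ (f , injective , edge) → record { vtx = f ; inj = injective _ _ ; isEdge = edge })
      (λ p → vtx p , (λ _ _ → inj p) , isEdge p) (∃-function? {P = IsPath} IsPath? IsPath-cong))

    Colouring : Set
    Colouring = V → V → ℕ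

    IsProper : Colouring → Set
    IsProper κ = (∀ u v → adj G u v ≡ true → κ u v ≡ κ v u) ×
      (∀ u v w → adj G u v ≡ true → adj G u w ≡ true → v ≢ w → κ u v ≢ κ u w)

    RainbowVia : Colouring → (Fin (suc l) → V) → Set
    RainbowVia κ f = ∀ i j → κ (f (inject₁ i)) (f (suc i)) ≡ κ (f (inject₁ j)) (f (suc j)) → i ≡ j

    AvoidsRainbow : Colouring → Set
    AvoidsRainbow κ = IsProper κ × ¬ (∃ λ f → IsPath f × RainbowVia κ f)

    AvoidsRainbow? : ∀ κ → Dec (AvoidsRainbow κ)
    AvoidsRainbow? κ =
      (all? (λ u → all? λ v → (adj G u v Bool.≟ true) →-dec (κ u v ℕ.≟ κ v u)) ×-dec
       all? (λ u → all? λ v → all? λ w → (adj G u v Bool.≟ true) →-dec ((adj G u w Bool.≟ true) →-dec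
         (¬? (v ≟ w) →-dec ¬? (κ u v ℕ.≟ κ u w))))) ×-dec
      ¬? (∃-function? (λ f → IsPath? f ×-dec
            all? λ i → all? λ j → (κ (f (inject₁ i)) (f (suc i)) ℕ.≟ κ (f (inject₁ j)) (f (suc j))) →-dec (i ≟ j))
          (λ e (p , r) → IsPath-cong e p , λ i j q → r i j (trans (cong₂ κ (e _) (e _)) (trans q (sym (cong₂ κ (e _) (e _)))))))

    -- Properness and rainbow paths depend only on which pairs of vertices have equal colours.
    AvoidsRainbow-recolour : ∀ {κ κ′} → (∀ u v x y → κ u v ≡ κ x y → κ′ u v ≡ κ′ x y) →
      (∀ u v x y → κ′ u v ≡ κ′ x y → κ u v ≡ κ x y) → AvoidsRainbow κ → AvoidsRainbow κ′
    AvoidsRainbow-recolour to from ((symmetric , proper) , none) =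
      ((λ u v a → to u v v u (symmetric u v a)) , λ u v w a b v≢w e → proper u v w a b v≢w (from u v u w e))
      , λ (f , p , r) → none (f , p , λ i j e → r i j (to _ _ _ _ e))

    edgeColour : Colouring → Fin (n * n) → ℕ
    edgeColour κ x = let u , v = remQuot n x in κ u v

    -- A colouring takes at most `n * n` values, one for each ordered pair, so after renaming it is
    -- a matrix over `suc (n * n)` colours, with index `zero` for values that do not occur.
    rainbow-path-free? : Dec (RainbowPathFree G l)
    rainbow-path-free? = map′ to from (∃-matrix? {k = suc (n * n)} (λ M → AvoidsRainbow? (λ u v → toℕ (M u v)))
        (λ e → AvoidsRainbow-recolour (λ u v x y q → trans (cong toℕ (sym (e u v))) (trans q (cong toℕ (e x y))))
                                      (λ u v x y q → trans (cong toℕ (e u v)) (trans q (cong toℕ (sym (e x y)))))))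
      where
      to : _ → RainbowPathFree G l
      to (M , (symmetric , proper) , none) = record { col = λ u v → toℕ (M u v) ; colSym = symmetric ; proper = proper }
        , λ p r → none (vtx p , ((λ _ _ → inj p) , isEdge p) , λ _ _ → r)
      from : RainbowPathFree G l → _
      from (c , none) = (λ u v → rename (col c u v)) , AvoidsRainbow-recolour {κ = col c}
        (λ u v x y → cong (toℕ ∘ rename))
        (λ u v x y e → rename-injective (combine u v , cong (λ (u , v) → col c u v) (remQuot-combine u v)) (toℕ-injective e))
        ((colSym c , proper c) , λ (f , (injective , edge) , r) →
          none (record { vtx = f ; inj = injective _ _ ; isEdge = edge }) (r _ _))
        where open Renaming (edgeColour (col c))

  path-free-cong : ∀ {l G H} → G ≈ H → PathFree G l → PathFree H l
  path-free-cong {l} {G} {H} e free p = free (path-cong {H} {G} (λ i j → sym (e i j)) p)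

  rainbow-path-free-cong : ∀ {l G H} → G ≈ H → RainbowPathFree G l → RainbowPathFree H l
  rainbow-path-free-cong {l} {G} {H} e (c , free) = record
      { col = col c
      ; colSym = λ u v a → colSym c u v (trans (e u v) a)
      ; proper = λ u v w a b → proper c u v w (trans (e u v) a) (trans (e u w) b) }
    , λ p r → free (path-cong {H} {G} (λ i j → sym (e i j)) p) r

theorem9 : ∀ (l : ℕ) → 1 ≤ l →
  -- ex(n,P_l) and ex*(n,P_l) exist (well-definedness)
  (∀ n → ∃ λ m → IsEx n l m) ×
  (∀ n → ∃ λ m → IsExStar n l m) ×
  -- ex(n,P_l) ~ ((l-1)/2) n : for every ε = 1/(k+1) there is N such that
  -- for n ≥ N, |ex(n,P_l) - ((l-1)/2) n| ≤ n/(k+1)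
  (∀ (k : ℕ) → ∃ λ N → ∀ n → N ≤ n → ∀ m → IsEx n l m →
      (2 * suc k * m ≤ (l ∸ 1) * suc k * n + 2 * n) ×
      ((l ∸ 1) * suc k * n ≤ 2 * suc k * m + 2 * n)) ×
  -- ex(n,P_l) ≤ ex*(n,P_l) ≤ ⌈(3l-2)/2⌉ n
  (∀ n m m* → IsEx n l m → IsExStar n l m* →
      (m ≤ m*) × (m* ≤ ⌈ 3 * l ∸ 2 /2⌉ * n))
theorem9 l l≥1 = ex-exists , ex*-exists , asymptotics , bounds
  where
  open ≤-Reasoning
  instance _ = ℕ.>-nonZero l≥1
  open Cliques l

  ex-exists : ∀ n → ∃ λ m → IsEx n l m
  -- Any bound can start the search; this one drops the factor 2 in `path-free-edges` and so avoids
  -- a division.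
  ex-exists n = maximum (λ G → path-free? G l) path-free-cong (cliques n , cliques-path-free n) ((l ∸ 1) * n)
    (λ G free → ≤-trans (m≤m+n (edges G) _) (path-free-edges G l l≥1 free))

  ex*-exists : ∀ n → ∃ λ m → IsExStar n l m
  ex*-exists n = maximum (λ G → rainbow-path-free? G l) rainbow-path-free-cong
    (cliques n , path-free⇒rainbow-path-free _ l (cliques-path-free n)) _
    (λ G free → rainbow-path-free-edges G l free)

  asymptotics : ∀ k → ∃ λ N → ∀ n → N ≤ n → ∀ m → IsEx n l m →
    (2 * suc k * m ≤ (l ∸ 1) * suc k * n + 2 * n) × ((l ∸ 1) * suc k * n ≤ 2 * suc k * m + 2 * n)
  -- `N` is the loss `l * l` of `cliques-edges` after scaling by `suc k`, so that for `N ≤ n` the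
  -- loss stays within the permitted `2 * n`.
  asymptotics k = suc k * (l * l) , λ { n N≤n m ((G , free , refl) , greatest) →
    (begin
      2 * suc k * edges G ≡⟨ regroup 2 (suc k) (edges G) ⟩
      suc k * (2 * edges G) ≤⟨ *-monoʳ-≤ (suc k) (path-free-edges G l l≥1 free) ⟩
      suc k * ((l ∸ 1) * n) ≡⟨ regroup (l ∸ 1) (suc k) n ⟨
      (l ∸ 1) * suc k * n ≤⟨ m≤m+n _ (2 * n) ⟩
      (l ∸ 1) * suc k * n + 2 * n ∎)
    , (begin
      (l ∸ 1) * suc k * n ≡⟨ regroup (l ∸ 1) (suc k) n ⟩
      suc k * ((l ∸ 1) * n) ≤⟨ *-monoʳ-≤ (suc k) (cliques-edges n) ⟩
      suc k * (2 * edges (cliques n) + l * l)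
        ≤⟨ *-monoʳ-≤ (suc k) (+-monoˡ-≤ (l * l) (*-monoʳ-≤ 2 (greatest (cliques n) (cliques-path-free n)))) ⟩
      suc k * (2 * edges G + l * l) ≡⟨ *-distribˡ-+ (suc k) (2 * edges G) (l * l) ⟩
      suc k * (2 * edges G) + suc k * (l * l) ≤⟨ +-monoʳ-≤ (suc k * (2 * edges G)) (≤-trans N≤n (m≤m+n n _)) ⟩
      suc k * (2 * edges G) + 2 * n ≡⟨ cong (_+ 2 * n) (regroup 2 (suc k) (edges G)) ⟨
      2 * suc k * edges G + 2 * n ∎) }
    where
    regroup : ∀ x y z → x * y * z ≡ y * (x * z)
    regroup = solve-∀

  bounds : ∀ n m m* → IsEx n l m → IsExStar n l m* → (m ≤ m*) × (m* ≤ ⌈ 3 * l ∸ 2 /2⌉ * n)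
  bounds n _ _ ((G , free , refl) , _) ((G* , free* , refl) , greatest) =
    -- The extremal graph for ex competes in the maximum defining ex*.
    greatest G (path-free⇒rainbow-path-free G l free) , rainbow-path-free-edges G* l free*
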